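{- Every cycle graph $C_n$ of order $n\ge 6$ satisfies $\dim_{ms}(C_n)=3$.
   Context: For a simple connected graph $G$, $d_G(u,v)$ is the length of a shortest $u$–$v$ path. For $S=\{w_1,\ldots,w_t\}\subseteq V(G)$ and $u\in V(G)$, the multiset representation of $u$ with respect to $S$ is the multiset $\operatorname{m}(u|S)$ consisting of $d_G(u,w_1),\ldots,d_G(u,w_t)$, counted with multiplicity. A set $S$ is an outer multiset resolving set if $\operatorname{m}(u|S)\ne \operatorname{m}(v|S)$ for every two distinct $u,v\in V(G)\setminus S$; the outer multiset dimension $\dim_{ms}(G)$ is the minimum cardinality of such a set. -}

module Defs where

open import Data.Nat using (ℕ; zero; suc; _+_; _≤_; _<_; z≤n; s≤s)
open import Data.Nat.Properties as ℕ
  using (≤-trans; ≤-reflexive; n≤1+n; m≤m+n; +-identityʳ; +-suc; ≤-total; m≤n⇒∃[o]m+o≡n)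
open import Data.Fin using (Fin; toℕ; fromℕ<)
open import Data.Fin.Properties as Fin using (any?; all?; toℕ-injective; toℕ<n; toℕ-fromℕ<)
open import Data.Fin.Subset using (Subset; _∈_; _∉_; ∣_∣; ⊤)
open import Data.Fin.Subset.Properties using (_∈?_; ∈⊤; anySubset?)
open import Data.List as List using (List; []; _∷_; map; filter; allFin)
open import Data.List.Relation.Binary.Permutation.Propositional
  using (_↭_; ↭-refl; ↭-sym; ↭-trans; prep)
open import Data.List.Relation.Binary.Permutation.Propositional.Properties
  using (∈-resp-↭; drop-∷; shift; ¬x∷xs↭[])
open import Data.List.Membership.Propositional.Properties using (∈-∃++)
open import Data.List.Membership.DecPropositional ℕ._≟_ using () renaming (_∈?_ to _∈ₗ?_)
open import Data.List.Relation.Unary.Any using (here)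
open import Data.Product using (∃; ∃-syntax; _×_; _,_; proj₁; proj₂)
open import Data.Sum using (_⊎_; inj₁; inj₂)
open import Data.Vec as Vec using (Vec; []; _∷_)
open import Data.Vec.Relation.Unary.All using (All; []; _∷_)
open import Data.Vec.Relation.Unary.Any as Any using (here; there)
open import Data.Vec.Relation.Unary.AllPairs using ([]; _∷_; allPairs?)
open import Data.Vec.Relation.Unary.Linked using (Linked; [-]; _∷_; linked?)
open import Data.Vec.Relation.Unary.Unique.Propositional using (Unique)
open import Data.Vec.Membership.Propositional using () renaming (_∈_ to _∈ᵥ_)
open import Function using (_∘_)
open import Relation.Binary.Core using (Rel)
open import Relation.Binary.Definitions as B using (Symmetric)
open import Relation.Binary.PropositionalEquality
  using (_≡_; _≢_; refl; sym; trans; cong; subst)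
open import Relation.Nullary using (¬_; Dec; yes; no; contradiction)
open import Relation.Nullary.Decidable using (map′; ¬?; _×-dec_; _⊎-dec_; _→-dec_)
open import Relation.Unary using (Pred; Decidable)
open import Level using (0ℓ)

private
  variable
    n k : ℕ

IsMinimum : Pred ℕ 0ℓ → Pred ℕ 0ℓ
IsMinimum P m = P m × (∀ j → P j → m ≤ j)

minimum : {P : Pred ℕ 0ℓ} → Decidable P → ∃ P → ∃ (IsMinimum P)
minimum P? (k , pk) = go k P? pk
  where
  go : ∀ k {P : Pred ℕ 0ℓ} → Decidable P → P k → ∃ (IsMinimum P)
  go zero P? pk = 0 , pk , λ _ _ → z≤n
  go (suc k) P? pk with P? 0
  ... | yes p0 = 0 , p0 , λ _ _ → z≤n
  ... | no ¬p0 with go k (P? ∘ suc) pk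
  ...   | m , pm , least = suc m , pm , λ where
            zero    p0 → contradiction p0 ¬p0
            (suc j) pj → s≤s (least j pj)

-- A path of length k has k + 1 distinct vertices.
record Path (_~_ : Rel (Fin n) 0ℓ) (u v : Fin n) (k : ℕ) : Set where
  constructor path
  field
    vertices : Vec (Fin n) (suc k)
    starts   : Vec.head vertices ≡ u
    ends     : Vec.last vertices ≡ v
    linked   : Linked _~_ vertices
    distinct : Unique vertices

anyVec? : ∀ k {P : Pred (Vec (Fin n) k) 0ℓ} → Decidable P → Dec (∃ P)
anyVec? zero    P? = map′ ([] ,_) (λ { ([] , p) → p }) (P? [])
anyVec? (suc k) P? =
  map′ (λ (x , xs , p) → x ∷ xs , p) (λ { (x ∷ xs , p) → x , xs , p })
       (any? λ x → anyVec? k λ xs → P? (x ∷ xs))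

path? : {_~_ : Rel (Fin n) 0ℓ} → B.Decidable _~_ → ∀ u v → Decidable (Path _~_ u v)
path? _~?_ u v k =
  map′ (λ (vs , s , e , l , d) → path vs s e l d) (λ (path vs s e l d) → vs , s , e , l , d)
       (anyVec? (suc k) λ vs →
          (Vec.head vs Fin.≟ u) ×-dec (Vec.last vs Fin.≟ v) ×-dec
          linked? _~?_ vs ×-dec allPairs? (λ x y → ¬? (x Fin.≟ y)) vs)

record ConnectedGraph (n : ℕ) : Set₁ where
  field
    _~_       : Rel (Fin n) 0ℓ
    _~?_      : B.Decidable _~_
    symmetric : Symmetric _~_
    loopless  : ∀ {u} → ¬ (u ~ u)
    connected : ∀ u v → ∃[ k ] Path _~_ u v k

module _ (G : ConnectedGraph n) where
  open ConnectedGraph G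

  shortestPath : ∀ u v → ∃ (IsMinimum (Path _~_ u v))
  shortestPath u v = minimum (path? _~?_ u v) (connected u v)

  dist : Fin n → Fin n → ℕ
  dist u v = proj₁ (shortestPath u v)

  -- Multisets are lists up to the permutation relation _↭_.
  multisetRep : Fin n → Subset n → List ℕ
  multisetRep u S = map (dist u) (filter (_∈? S) (allFin n))

  IsOuterMultisetResolving : Pred (Subset n) 0ℓ
  IsOuterMultisetResolving S =
    ∀ u v → u ∉ S → v ∉ S → u ≢ v → ¬ (multisetRep u S ↭ multisetRep v S)

  HasResolvingSetOfSize : Pred ℕ 0ℓ
  HasResolvingSetOfSize k = ∃[ S ] ∣ S ∣ ≡ k × IsOuterMultisetResolving S

_↭?_ : B.Decidable (_↭_ {A = ℕ})
[]       ↭? []       = yes ↭-refl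
[]       ↭? (y ∷ ys) = no (¬x∷xs↭[] ∘ ↭-sym)
(x ∷ xs) ↭? ys with x ∈ₗ? ys
... | no x∉ys = no λ p → x∉ys (∈-resp-↭ p (here refl))
... | yes x∈ys with ∈-∃++ x∈ys
...   | as , bs , refl =
        map′ (λ p → ↭-trans (prep x p) (↭-sym (shift x as bs)))
             (λ p → drop-∷ (↭-trans p (shift x as bs)))
             (xs ↭? (as List.++ bs))

module _ (G : ConnectedGraph n) where

  isOuterMultisetResolving? : Decidable (IsOuterMultisetResolving G)
  isOuterMultisetResolving? S = all? λ u → all? λ v →
    ¬? (u ∈? S) →-dec ¬? (v ∈? S) →-dec ¬? (u Fin.≟ v) →-dec
    ¬? (multisetRep G u S ↭? multisetRep G v S)

  hasResolvingSetOfSize? : Decidable (HasResolvingSetOfSize G)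
  hasResolvingSetOfSize? k =
    anySubset? λ S → (∣ S ∣ ℕ.≟ k) ×-dec isOuterMultisetResolving? S

  smallestResolvingSet : ∃ (IsMinimum (HasResolvingSetOfSize G))
  smallestResolvingSet = minimum hasResolvingSetOfSize?
    (_ , ⊤ , refl , λ _ _ u∉⊤ → contradiction ∈⊤ u∉⊤)

  dimₘₛ : ℕ
  dimₘₛ = proj₁ smallestResolvingSet

module _ {_~_ : Rel (Fin n) 0ℓ} where

  trivialPath : ∀ u → Path _~_ u u 0
  trivialPath u = path (u ∷ []) refl refl [-] ([] ∷ [])

  -- If u already lies on the path, the path is cut off at u.
  extendPath : ∀ {u x v} → u ~ x → Path _~_ x v k → ∃[ j ] j ≤ suc k × Path _~_ u v j
  extendPath {u = u} u~x (path vs refl e l d) with Any.any? (u Fin.≟_) vs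
  ... | no u∉vs = _ , ℕ.≤-refl , path (u ∷ vs) refl e (u~x ∷ l) (fresh vs u∉vs ∷ d)
    where
    fresh : ∀ {k u} (vs : Vec (Fin n) k) → ¬ (u ∈ᵥ vs) → All (u ≢_) vs
    fresh []       _    = []
    fresh (x ∷ vs) u∉vs = u∉vs ∘ here ∷ fresh vs (u∉vs ∘ there)
  ... | yes u∈vs with cut vs e l d u∈vs
    where
    cut : ∀ {k u v} (vs : Vec (Fin n) (suc k)) → Vec.last vs ≡ v → Linked _~_ vs → Unique vs →
          u ∈ᵥ vs → ∃[ j ] j ≤ k × Path _~_ u v j
    cut vs@(_ ∷ _) e l d (here refl) = _ , ℕ.≤-refl , path vs refl e l d
    cut (_ ∷ vs@(_ ∷ _)) e (_ ∷ l) (_ ∷ d) (there u∈vs) with cut vs e l d u∈vs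
    ... | j , j≤k , p = j , ≤-trans j≤k (n≤1+n _) , p
  ...   | j , j≤k , p = j , ≤-trans j≤k (n≤1+n _) , p

-- j is the successor of i modulo n.
Next : Rel (Fin n) 0ℓ
Next {n} i j = suc (toℕ i) ≡ toℕ j ⊎ (suc (toℕ i) ≡ n × toℕ j ≡ 0)

next? : B.Decidable (Next {n})
next? {n} i j =
  (suc (toℕ i) ℕ.≟ toℕ j) ⊎-dec ((suc (toℕ i) ℕ.≟ n) ×-dec (toℕ j ℕ.≟ 0))

CycleAdj : Rel (Fin n) 0ℓ
CycleAdj i j = Next i j ⊎ Next j i

cycleAdj-sym : Symmetric (CycleAdj {n})
cycleAdj-sym (inj₁ p) = inj₂ p
cycleAdj-sym (inj₂ p) = inj₁ p

next-irrefl : 3 ≤ n → ∀ {i : Fin n} → ¬ Next i i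
next-irrefl _ (inj₁ eq) = ℕ.1+n≢n eq
next-irrefl 3≤n {i} (inj₂ (eq , i≡0))
  with s≤s () ← subst (3 ≤_) (trans (sym eq) (cong suc i≡0)) 3≤n

cycleAdj-irrefl : 3 ≤ n → ∀ {i : Fin n} → ¬ CycleAdj i i
cycleAdj-irrefl 3≤n (inj₁ p) = next-irrefl 3≤n p
cycleAdj-irrefl 3≤n (inj₂ p) = next-irrefl 3≤n p

cycle-ascend : ∀ d (u v : Fin n) → toℕ u + d ≡ toℕ v → ∃[ k ] Path CycleAdj u v k
cycle-ascend zero u v eq
  with refl ← toℕ-injective (trans (sym (+-identityʳ _)) eq) = 0 , trivialPath u
cycle-ascend {n} (suc d) u v eq =
  let j , _ , p = extendPath u~x (proj₂ (cycle-ascend d x v x+d≡v)) in j , p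
  where
  eq′ : suc (toℕ u) + d ≡ toℕ v
  eq′ = trans (sym (+-suc _ d)) eq
  1+u<n : suc (toℕ u) < n
  1+u<n = ℕ.≤-<-trans (≤-trans (m≤m+n _ d) (≤-reflexive eq′)) (toℕ<n v)
  x : Fin n
  x = fromℕ< 1+u<n
  u~x : CycleAdj u x
  u~x = inj₁ (inj₁ (sym (toℕ-fromℕ< 1+u<n)))
  x+d≡v : toℕ x + d ≡ toℕ v
  x+d≡v = trans (cong (_+ d) (toℕ-fromℕ< 1+u<n)) eq′

cycle-descend : ∀ d (u v : Fin n) → toℕ v + d ≡ toℕ u → ∃[ k ] Path CycleAdj u v k
cycle-descend zero u v eq
  with refl ← toℕ-injective (trans (sym (+-identityʳ _)) eq) = 0 , trivialPath u
cycle-descend {n} (suc d) u v eq =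
  let j , _ , p = extendPath u~x (proj₂ (cycle-descend d x v (sym toℕ-x))) in j , p
  where
  eq′ : suc (toℕ v + d) ≡ toℕ u
  eq′ = trans (sym (+-suc _ d)) eq
  v+d<n : toℕ v + d < n
  v+d<n = ≤-trans (≤-reflexive eq′) (ℕ.<⇒≤ (toℕ<n u))
  x : Fin n
  x = fromℕ< v+d<n
  toℕ-x : toℕ x ≡ toℕ v + d
  toℕ-x = toℕ-fromℕ< v+d<n
  u~x : CycleAdj u x
  u~x = inj₂ (inj₁ (trans (cong suc toℕ-x) eq′))

cycle-connected : ∀ (u v : Fin n) → ∃[ k ] Path CycleAdj u v k
cycle-connected u v with ≤-total (toℕ u) (toℕ v)
... | inj₁ u≤v = let d , eq = m≤n⇒∃[o]m+o≡n u≤v in cycle-ascend d u v eq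
... | inj₂ v≤u = let d , eq = m≤n⇒∃[o]m+o≡n v≤u in cycle-descend d u v eq

cycle : ∀ n → 3 ≤ n → ConnectedGraph n
cycle n 3≤n = record
  { _~_       = CycleAdj
  ; _~?_      = λ i j → next? i j ⊎-dec next? j i
  ; symmetric = cycleAdj-sym
  ; loopless  = cycleAdj-irrefl 3≤n
  ; connected = cycle-connected
  }

{-# OPTIONS --safe #-}
module Submission where

open import Defs
open import Data.Bool using (true; false)
open import Data.Fin using (Fin; zero; suc; toℕ; fromℕ<)
open import Data.Fin.Properties using (toℕ-injective; toℕ<n; toℕ-fromℕ<)
open import Data.Fin.Subset as Subset using (Subset; ⊥; ∣_∣; inside; outside)
open import Data.Fin.Subset.Properties using (_∈?_; ∉⊥; ∣⊥∣≡0)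
open import Data.List using (List; []; _∷_; map; filter; length; tabulate; allFin)
open import Data.List.Membership.Propositional using (_∉_)
open import Data.List.Membership.Propositional.Properties using (∈-filter⁺; ∈-allFin)
open import Data.List.Properties using (filter-none)
open import Data.List.Relation.Binary.Permutation.Propositional
  using (_↭_; ↭-refl; ↭-sym; ↭-trans; ↭-swap; ↭-prep; ↭-reflexive; ↭⇒↭ₛ)
open import Data.List.Relation.Binary.Permutation.Propositional.Properties using (↭-reverse; shift)
open import Data.List.Relation.Binary.Pointwise as Pointwise using ()
open import Data.List.Relation.Unary.All as All using ()
open import Data.List.Relation.Unary.All.Properties as All using ()
open import Data.List.Relation.Unary.AllPairs as AllPairs using ()
open import Data.List.Relation.Unary.Any using (here; there)
open import Data.List.Relation.Unary.Linked as ListLinked using ()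
open import Data.List.Relation.Unary.Sorted.TotalOrder.Properties using (↗↭↗⇒≋)
open import Data.List.Relation.Unary.Unique.Propositional using (Unique)
open import Data.List.Relation.Unary.Unique.Propositional.Properties using (filter⁺; allFin⁺)
open import Data.Nat using (ℕ; zero; suc; _+_; _≤_; _<_; z≤n; s≤s; z<s; s<s)
open import Data.Nat.Properties
open import Data.List.Relation.Unary.Sorted.TotalOrder ≤-totalOrder using (Sorted)
open import Data.Nat.Tactic.RingSolver using (solve)
open import Data.Product using (∃-syntax; _×_; _,_; proj₁; proj₂)
open import Data.Sum as Sum using (_⊎_; inj₁; inj₂)
open import Data.Vec as Vec using (Vec)
open import Data.Vec.Relation.Unary.Linked as Linked using (Linked; [-])
open import Function using (_∘_)
open import Relation.Binary.Definitions using (tri<; tri≈; tri>)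
open import Relation.Binary.PropositionalEquality
  using (_≡_; _≢_; refl; sym; trans; cong; cong₂; subst)
open import Relation.Nullary using (¬_; does; yes; no; contradiction)
open import Relation.Unary using (Decidable)

-- No set of at most two vertices resolves: a reflection of the cycle preserves it and
-- exchanges two vertices outside it. For {x , y} these are the neighbours of x and y
-- inside an arc of length at least 3 between them, which exists as n ≥ 6.
-- Conversely {0 , 1 , 3} resolves: sort the three distances from u. The gaps are (2 , 1)
-- while they all increase with u, (1 , 2) while they all decrease, and differ
-- from these at 2 and at the vertices opposite to 0 , 1 , 3; given the gaps
-- (and n), the smallest distance determines u.

private
  variable
    n k d e i j x y p q : ℕ

-- Linear arithmetic by certificates: the last premise, a semiring identity,
-- exhibits the goal as a consequence of the hypothesis x ≤ y (or x ≡ y).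

linear-≤ : ∀ c → x ≤ y → p + (y + c) ≡ q + x → p ≤ q
linear-≤ {x} {y} {p} {q} c x≤y eq = +-cancelʳ-≤ x p q
  (≤-trans (+-monoʳ-≤ p (≤-trans x≤y (m≤m+n y c))) (≤-reflexive eq))

linear-≡ : x ≡ y → p + y ≡ q + x → p ≡ q
linear-≡ {x} {p = p} {q} refl eq = +-cancelʳ-≡ x p q eq

linear-⊥ : ∀ {a} {A : Set a} c → x ≤ y → x ≡ suc (y + c) → A
linear-⊥ {y = y} c x≤y refl = contradiction (≤-trans (s≤s (m≤m+n y c)) x≤y) 1+n≰n

-- Arcs and cyclic distance as arithmetic modulo `n`.

-- Going d steps up from i on the n-cycle ends in j.
Arc : ℕ → ℕ → ℕ → ℕ → Set
Arc n i j d = i + d ≡ j ⊎ i + d ≡ j + n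

-- The cyclic distance of i and j is at most k; the last two cases pass between n ∸ 1 and 0.
Within : ℕ → ℕ → ℕ → ℕ → Set
Within n i j k = (i ≤ j + k × j ≤ i + k) ⊎ (i + n ≤ j + k ⊎ j + n ≤ i + k)

-- As `d + d ≤ n`, the arc is no longer than its complement `n ∸ d`, so a bound on either way round
-- bounds `d`.
within-≤ : Arc n i j d → d + d ≤ n → Within n i j k → d ≤ k
within-≤ {n} {i} {j} {d} {k} (inj₁ eq) d+d≤n (inj₁ (_ , p)) =
  linear-≤ 0 (+-mono-≤ (≤-reflexive eq) p) (solve (n ∷ i ∷ j ∷ d ∷ k ∷ []))
within-≤ {n} {i} {j} {d} {k} (inj₁ eq) d+d≤n (inj₂ (inj₁ p)) =
  linear-≤ 0 (+-mono-≤ (+-mono-≤ (≤-reflexive (sym eq)) p) d+d≤n) (solve (n ∷ i ∷ j ∷ d ∷ k ∷ []))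
within-≤ {n} {i} {j} {d} {k} (inj₁ eq) d+d≤n (inj₂ (inj₂ p)) =
  linear-≤ n (+-mono-≤ (≤-reflexive eq) p) (solve (n ∷ i ∷ j ∷ d ∷ k ∷ []))
within-≤ {n} {i} {j} {d} {k} (inj₂ eq) d+d≤n (inj₁ (p , _)) =
  linear-≤ 0 (+-mono-≤ (+-mono-≤ (≤-reflexive (sym eq)) p) d+d≤n) (solve (n ∷ i ∷ j ∷ d ∷ k ∷ []))
within-≤ {n} {i} {j} {d} {k} (inj₂ eq) d+d≤n (inj₂ (inj₁ p)) =
  linear-≤ n (+-mono-≤ (+-mono-≤ (≤-reflexive (sym eq)) p) d+d≤n) (solve (n ∷ i ∷ j ∷ d ∷ k ∷ []))
within-≤ {n} {i} {j} {d} {k} (inj₂ eq) d+d≤n (inj₂ (inj₂ p)) =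
  linear-≤ 0 (+-mono-≤ (≤-reflexive eq) p) (solve (n ∷ i ∷ j ∷ d ∷ k ∷ []))

within-next : j < n → suc i ≡ x ⊎ (suc i ≡ n × x ≡ 0) → Within n x j k → Within n i j (suc k)
within-next {j} {n} {i} {x} {k} _ (inj₁ refl) (inj₁ (p , q)) =
  inj₁ (linear-≤ 2 p (solve (i ∷ j ∷ k ∷ [])) , linear-≤ 0 q (solve (i ∷ j ∷ k ∷ [])))
within-next {j} {n} {i} {x} {k} _ (inj₁ refl) (inj₂ (inj₁ p)) =
  inj₂ (inj₁ (linear-≤ 2 p (solve (n ∷ i ∷ j ∷ k ∷ []))))
within-next {j} {n} {i} {x} {k} _ (inj₁ refl) (inj₂ (inj₂ p)) =
  inj₂ (inj₂ (linear-≤ 0 p (solve (n ∷ i ∷ j ∷ k ∷ []))))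
within-next {j} {n} {i} {x} {k} _ (inj₂ (refl , refl)) (inj₁ (_ , p)) =
  inj₂ (inj₂ (linear-≤ 0 p (solve (i ∷ j ∷ k ∷ []))))
-- Here `i` is `n ∸ 1`, so `j < n` already gives `j ≤ i`.
within-next {j} {n} {i} {x} {k} j<n (inj₂ (refl , refl)) (inj₂ (inj₁ p)) =
  inj₁ (linear-≤ 2 p (solve (i ∷ j ∷ k ∷ [])) , linear-≤ (1 + k) j<n (solve (i ∷ j ∷ k ∷ [])))
within-next {j} {n} {i} {x} {k} _ (inj₂ (refl , refl)) (inj₂ (inj₂ p)) =
  inj₂ (inj₂ (linear-≤ (1 + i) p (solve (i ∷ j ∷ k ∷ []))))

within-prev : suc x ≡ i ⊎ (suc x ≡ n × i ≡ 0) → Within n x j k → Within n i j (suc k)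
within-prev {x} {i} {n} {j} {k} (inj₁ refl) (inj₁ (p , q)) =
  inj₁ (linear-≤ 0 p (solve (x ∷ j ∷ k ∷ [])) , linear-≤ 2 q (solve (x ∷ j ∷ k ∷ [])))
within-prev {x} {i} {n} {j} {k} (inj₁ refl) (inj₂ (inj₁ p)) =
  inj₂ (inj₁ (linear-≤ 0 p (solve (n ∷ x ∷ j ∷ k ∷ []))))
within-prev {x} {i} {n} {j} {k} (inj₁ refl) (inj₂ (inj₂ p)) =
  inj₂ (inj₂ (linear-≤ 2 p (solve (n ∷ x ∷ j ∷ k ∷ []))))
within-prev {x} {i} {n} {j} {k} (inj₂ (refl , refl)) (inj₁ (p , _)) =
  inj₂ (inj₁ (linear-≤ 0 p (solve (x ∷ j ∷ k ∷ []))))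
within-prev {x} {i} {n} {j} {k} (inj₂ (refl , refl)) (inj₂ (inj₁ p)) =
  inj₂ (inj₁ (linear-≤ (1 + x) p (solve (x ∷ j ∷ k ∷ []))))
within-prev {x} {i} {n} {j} {k} (inj₂ (refl , refl)) (inj₂ (inj₂ p)) =
  inj₁ (z≤n , linear-≤ 2 p (solve (x ∷ j ∷ k ∷ [])))

-- The arcs from `i` to `j` and from `j` back to `i` make one full turn.
arc-flip : Arc n i j d → d + e ≡ n → Arc n j i e
arc-flip {n} {i} {j} {d} {e} (inj₁ refl) refl = inj₂ (+-assoc i d e)
arc-flip {n} {i} {j} {d} {e} (inj₂ eq)   refl =
  inj₁ (linear-≡ (sym eq) (solve (i ∷ j ∷ d ∷ e ∷ [])))

-- A point `x` on the way splits the arc, and the second piece remains. If the first piece wraps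
-- past 0, the whole arc has to wrap as well, because `j < n`.
arc-cancel : j < n → Arc n i x d → Arc n i j (d + e) → Arc n x j e
arc-cancel {j} {n} {i} {x} {d} {e} _ (inj₁ refl) (inj₁ eq) = inj₁ (trans (+-assoc i d e) eq)
arc-cancel {j} {n} {i} {x} {d} {e} _ (inj₁ refl) (inj₂ eq) = inj₂ (trans (+-assoc i d e) eq)
arc-cancel {j} {n} {i} {x} {d} {e} j<n (inj₂ eq) (inj₁ refl) =
  linear-⊥ (x + e) (+-mono-≤ j<n (≤-reflexive (sym eq))) (solve (n ∷ i ∷ x ∷ d ∷ e ∷ []))
arc-cancel {j} {n} {i} {x} {d} {e} _ (inj₂ eq) (inj₂ eq′) =
  inj₁ (linear-≡ (cong₂ _+_ (sym eq) eq′) (solve (n ∷ i ∷ j ∷ x ∷ d ∷ e ∷ [])))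

arc-loop : Arc n i i d → d ≡ 0 ⊎ d ≡ n
arc-loop {n} {i} {d} (inj₁ eq) = inj₁ (+-cancelˡ-≡ i d 0 (trans eq (sym (+-identityʳ i))))
arc-loop {n} {i} {d} (inj₂ eq) = inj₂ (+-cancelˡ-≡ i d n eq)

-- Walks, and how they relate to paths and arcs.

-- Unlike a `Path`, a walk may repeat vertices, so it can be built along an arc and reversed freely.
-- Shortest lengths are unaffected, since a walk can be cut down to a path.
data Walk (_~_ : Fin n → Fin n → Set) : Fin n → Fin n → ℕ → Set where
  stop : ∀ {u} → Walk _~_ u u 0
  step : ∀ {u v w k} → u ~ v → Walk _~_ v w k → Walk _~_ u w (suc k)

module _ {_~_ : Fin n → Fin n → Set} where

  snoc : ∀ {u v w} → Walk _~_ u v k → v ~ w → Walk _~_ u w (suc k)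
  snoc stop         v~w = step v~w stop
  snoc (step r walk) v~w = step r (snoc walk v~w)

  reverse : (∀ {u v} → u ~ v → v ~ u) → ∀ {u v} → Walk _~_ u v k → Walk _~_ v u k
  reverse ~-sym stop          = stop
  reverse ~-sym (step r walk) = snoc (reverse ~-sym walk) (~-sym r)

  walk⇒path : ∀ {u v} → Walk _~_ u v k → ∃[ j ] j ≤ k × Path _~_ u v j
  walk⇒path stop          = 0 , z≤n , trivialPath _
  walk⇒path (step r walk) =
    let _ , i≤k , p = walk⇒path walk
        j , j≤1+i , q = extendPath r p
    in j , ≤-trans j≤1+i (s≤s i≤k) , q

  path⇒walk : ∀ {u v} → Path _~_ u v k → Walk _~_ u v k
  path⇒walk (path vs refl refl l _) = linked⇒walk vs l
    where
    linked⇒walk : ∀ {k} (vs : Vec (Fin n) (suc k)) → Linked _~_ vs →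
                  Walk _~_ (Vec.head vs) (Vec.last vs) k
    linked⇒walk (_ Vec.∷ Vec.[])       _              = stop
    linked⇒walk (_ Vec.∷ vs@(_ Vec.∷ _)) (r Linked.∷ l) = step r (linked⇒walk vs l)

next : (u : Fin n) → ∃[ v ] Next u v
next {suc n} u with suc (toℕ u) <? suc n
... | yes 1+u<n = fromℕ< 1+u<n , inj₁ (sym (toℕ-fromℕ< 1+u<n))
... | no  1+u≮n = zero , inj₂ (≤-antisym (toℕ<n u) (≮⇒≥ 1+u≮n) , refl)

arc-next : suc i ≡ x ⊎ (suc i ≡ n × x ≡ 0) → j < n → Arc n i j (suc d) → Arc n x j d
arc-next {i = i} {j = j} {d = d} (inj₁ refl) _ (inj₁ eq) = inj₁ (trans (sym (+-suc i d)) eq)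
arc-next {i = i} {j = j} {d = d} (inj₁ refl) _ (inj₂ eq) = inj₂ (trans (sym (+-suc i d)) eq)
arc-next {i = i} {d = d} (inj₂ (refl , refl)) j<n (inj₁ refl) =
  linear-⊥ d j<n (solve (i ∷ d ∷ []))
arc-next {i = i} {j = j} {d = d} (inj₂ (refl , refl)) j<n (inj₂ eq) =
  inj₁ (linear-≡ eq (solve (i ∷ j ∷ d ∷ [])))

arc⇒walk : ∀ {u v : Fin n} → Arc n (toℕ u) (toℕ v) d → Walk CycleAdj u v d
arc⇒walk {d = zero} {u} {v} (inj₁ eq)
  with refl ← toℕ-injective (trans (sym (+-identityʳ _)) eq) = stop
arc⇒walk {n} {d = zero} {u} {v} (inj₂ eq) = contradiction
  (subst (n ≤_) (trans (sym eq) (+-identityʳ (toℕ u))) (m≤n+m n (toℕ v))) (<⇒≱ (toℕ<n u))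
arc⇒walk {d = suc d} {u} {v} arc =
  let x , u→x = next u in step (inj₁ u→x) (arc⇒walk (arc-next u→x (toℕ<n v) arc))

-- Each edge changes the cyclic distance by at most one. With `within-≤` this bounds the length of
-- every walk from below.
walk⇒within : ∀ {u v : Fin n} → Walk CycleAdj u v k → Within n (toℕ u) (toℕ v) k
walk⇒within stop = inj₁ (m≤m+n _ 0 , m≤m+n _ 0)
walk⇒within {v = v} (step (inj₁ u→x) walk) = within-next (toℕ<n v) u→x (walk⇒within walk)
walk⇒within         (step (inj₂ x→u) walk) = within-prev x→u (walk⇒within walk)

-- Distances in the cycle.

module _ (3≤n : 3 ≤ n) where

  private
    δ : Fin n → Fin n → ℕ
    δ = dist (cycle n 3≤n)

  dist-walk : ∀ u v → Walk CycleAdj u v (δ u v)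
  dist-walk u v = path⇒walk (proj₁ (proj₂ (shortestPath (cycle n 3≤n) u v)))

  dist-≤ : ∀ {u v} → Walk CycleAdj u v k → δ u v ≤ k
  dist-≤ {u = u} {v} walk =
    let j , j≤k , p = walk⇒path walk
    in ≤-trans (proj₂ (proj₂ (shortestPath (cycle n 3≤n) u v)) j p) j≤k

  dist-sym : ∀ u v → δ u v ≡ δ v u
  dist-sym u v = ≤-antisym (dist-≤ (reverse cycleAdj-sym (dist-walk v u)))
                           (dist-≤ (reverse cycleAdj-sym (dist-walk u v)))

  -- The arc is itself a walk, which gives the upper bound; a shortest walk cannot beat an arc of at
  -- most half the cycle.
  arc⇒dist : ∀ u v → Arc n (toℕ u) (toℕ v) d → d + d ≤ n → δ u v ≡ d
  arc⇒dist u v arc d+d≤n =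
    ≤-antisym (dist-≤ (arc⇒walk arc)) (within-≤ arc d+d≤n (walk⇒within (dist-walk u v)))

  arc⇒dist′ : ∀ u v → Arc n (toℕ u) (toℕ v) d → d + d ≤ n → δ v u ≡ d
  arc⇒dist′ u v arc d+d≤n = trans (dist-sym v u) (arc⇒dist u v arc d+d≤n)

  -- This is the invariance of distance under rotations and reflections, usable without knowing
  -- which way round is shorter.
  dist-arc-cong : ∀ u v u′ v′ → Arc n (toℕ u) (toℕ v) d → Arc n (toℕ u′) (toℕ v′) d →
                  d ≤ n → δ u v ≡ δ u′ v′
  dist-arc-cong {d} u v u′ v′ arc arc′ d≤n with d + d ≤? n | m≤n⇒∃[o]m+o≡n d≤n
  ... | yes d+d≤n | _ = trans (arc⇒dist u v arc d+d≤n) (sym (arc⇒dist u′ v′ arc′ d+d≤n))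
  -- Both arcs exceed half the cycle, so their complements, of common length `e`, realise the
  -- distances.
  ... | no  d+d≰n | e , refl =
    trans (arc⇒dist′ v u (arc-flip arc refl) e+e≤n)
          (sym (arc⇒dist′ v′ u′ (arc-flip arc′ refl) e+e≤n))
    where
    e+e≤n : e + e ≤ d + e
    e+e≤n = +-monoˡ-≤ e (+-cancelˡ-≤ d e d (<⇒≤ (≰⇒> d+d≰n)))

-- Choosing vertices along arcs.

arc-≢ : ∀ {u v : Fin n} → Arc n (toℕ u) (toℕ v) d → 0 < d → d < n → u ≢ v
arc-≢ arc 0<d d<n refl with arc-loop arc
... | inj₁ refl = contradiction 0<d n≮0
... | inj₂ refl = contradiction d<n (<-irrefl refl)

arc-from : ∀ (u : Fin n) d → d ≤ n → ∃[ v ] Arc n (toℕ u) (toℕ v) d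
arc-from {n} u d d≤n with toℕ u + d <? n
... | yes u+d<n = fromℕ< u+d<n , inj₁ (sym (toℕ-fromℕ< u+d<n))
... | no  u+d≮n =
  let o , n+o≡u+d = m≤n⇒∃[o]m+o≡n (≮⇒≥ u+d≮n)
      o<n = +-cancelˡ-< n o n (≤-<-trans (≤-reflexive n+o≡u+d) (+-mono-<-≤ (toℕ<n u) d≤n))
  in fromℕ< o<n ,
     inj₂ (trans (sym n+o≡u+d) (trans (+-comm n o) (cong (_+ n) (sym (toℕ-fromℕ< o<n)))))

-- If the ascending arc has length 1 or 2, its complement has length at least 4. Length `3 + e`
-- leaves room for two distinct vertices next to the ends.
long-arc< : 6 ≤ n → i < j → j < n →
            ∃[ e ] 3 + e < n × (Arc n i j (3 + e) ⊎ Arc n j i (3 + e))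
long-arc< {i = i} 6≤n i<j j<n with m≤n⇒∃[o]m+o≡n 6≤n | m≤n⇒∃[o]m+o≡n i<j
... | m , refl | 0 , refl = 2 + m , ≤-refl , inj₂ (arc-flip (inj₁ (+-suc i 0)) refl)
... | m , refl | 1 , refl = 1 + m , n≤1+n _ , inj₂ (arc-flip (inj₁ (+-suc i 1)) refl)
... | m , refl | suc (suc e) , refl =
  e , ≤-<-trans (≤-trans (m≤n+m (3 + e) i) (≤-reflexive (+-suc i _))) j<n , inj₁ (inj₁ (+-suc i _))

long-arc : 6 ≤ n → i < n → j < n → i ≢ j →
           ∃[ e ] 3 + e < n × (Arc n i j (3 + e) ⊎ Arc n j i (3 + e))
long-arc {i = i} {j} 6≤n i<n j<n i≢j with <-cmp i j
... | tri< i<j _ _ = long-arc< 6≤n i<j j<n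
... | tri≈ _ i≡j _ = contradiction i≡j i≢j
... | tri> _ _ j<i = let e , e<n , arc = long-arc< 6≤n j<i i<n in e , e<n , Sum.swap arc

-- Vertex sets as lists.

-- `P?` and `f` are general so that the induction on `S` can pass to `f ∘ suc`.
length-filter-tabulate : ∀ {A : Set} {P : A → Set} (P? : Decidable P) (S : Subset n) (f : Fin n → A) →
                         (∀ i → does (P? (f i)) ≡ Vec.lookup S i) →
                         length (filter P? (tabulate f)) ≡ ∣ S ∣
length-filter-tabulate P? Vec.[]      f eq = refl
length-filter-tabulate P? (s Vec.∷ S) f eq with does (P? (f zero)) | eq zero
... | true  | refl = cong suc (length-filter-tabulate P? S (f ∘ suc) (eq ∘ suc))
... | false | refl = length-filter-tabulate P? S (f ∘ suc) (eq ∘ suc)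

does-∈? : ∀ (i : Fin n) (S : Subset n) → does (i ∈? S) ≡ Vec.lookup S i
does-∈? zero    (inside  Vec.∷ _) = refl
does-∈? zero    (outside Vec.∷ _) = refl
does-∈? (suc i) (_       Vec.∷ S) = does-∈? i S

-- This is the list over which `multisetRep` maps the distances. It lets small sets be treated by
-- matching on a list of length at most 2.
members : Subset n → List (Fin n)
members {n} S = filter (_∈? S) (allFin n)

length-members : ∀ (S : Subset n) → length (members S) ≡ ∣ S ∣
length-members S = length-filter-tabulate (_∈? S) S _ (λ i → does-∈? i S)

∉-pair : ∀ {A : Set} {z x y : A} → z ≢ x → z ≢ y → z ∉ x ∷ y ∷ []
∉-pair z≢x z≢y (here z≡x)         = z≢x z≡x
∉-pair z≢x z≢y (there (here z≡y)) = z≢y z≡y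

swapped : ∀ {A : Set} {a b c d : A} → a ≡ d → b ≡ c → a ∷ b ∷ [] ↭ c ∷ d ∷ []
swapped refl refl = ↭-swap _ _ ↭-refl

-- Lower bound: at most two vertices do not resolve.

module _ (3≤n : 3 ≤ n) where

  private
    δ : Fin n → Fin n → ℕ
    δ = dist (cycle n 3≤n)

  Confuses : List (Fin n) → Set
  Confuses xs = ∃[ u ] ∃[ v ] u ∉ xs × v ∉ xs × u ≢ v × map (δ u) xs ↭ map (δ v) xs

  confuses-[] : Confuses []
  confuses-[] =
    let 0<n = ≤-trans (s≤s z≤n) 3≤n
        1<n = ≤-trans (s≤s (s≤s z≤n)) 3≤n
        u = fromℕ< 0<n
        v , u→v = arc-from u 1 0<n
    in u , v , (λ ()) , (λ ()) , arc-≢ u→v z<s 1<n , ↭-refl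

  -- The reflection fixing `x` exchanges its two neighbours.
  confuses-[x] : ∀ x → Confuses (x ∷ [])
  confuses-[x] x with e , refl ← m≤n⇒∃[o]m+o≡n 3≤n =
    let u , x→u = arc-from x 1 (s≤s z≤n)
        -- Since `n` is `3 + e`, this arc ends at the predecessor of `x`.
        v , x→v = arc-from x (2 + e) (n≤1+n _)
        v→x = arc-flip x→v (cong (2 +_) (+-comm e 1))
        u→v = arc-cancel {i = toℕ x} (toℕ<n v) x→u x→v
    in u , v ,
       (λ { (here u≡x) → arc-≢ x→u z<s (s<s z<s) (sym u≡x) }) ,
       (λ { (here v≡x) → arc-≢ v→x z<s (s<s z<s) v≡x }) ,
       arc-≢ u→v z<s (n≤1+n _) ,
       ↭-reflexive (cong (_∷ []) (trans (dist-sym 3≤n u x)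
         (dist-arc-cong 3≤n x u v x x→u v→x (s≤s z≤n))))

  -- The reflection exchanging `x` and `y` exchanges `u`, one step after `x`, and `v`, one step
  -- before `y`. The arcs `x` to `u` and `v` to `y` have length 1, those from `u` to `y` and `x` to
  -- `v` length `2 + e`.
  inner-neighbours : ∀ x y → Arc n (toℕ x) (toℕ y) (3 + e) → 3 + e < n →
    ∃[ u ] ∃[ v ] (u ≢ x × u ≢ y) × (v ≢ x × v ≢ y) × u ≢ v × δ u x ≡ δ v y × δ u y ≡ δ v x
  inner-neighbours {e} x y x→y e<n =
    let 2+e<n = ≤-trans (n≤1+n _) e<n
        1<n = ≤-trans (s<s z<s) e<n
        1+e<n = ≤-trans (n≤1+n _) 2+e<n
        u , x→u = arc-from x 1 (<⇒≤ 1<n)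
        v , x→v = arc-from x (2 + e) (<⇒≤ 2+e<n)
        u→y = arc-cancel {i = toℕ x} (toℕ<n y) x→u x→y
        v→y = arc-cancel {i = toℕ x} (toℕ<n y) x→v (subst (Arc n _ _) (+-comm 1 (2 + e)) x→y)
        u→v = arc-cancel {i = toℕ x} (toℕ<n v) x→u x→v
    in u , v ,
       (arc-≢ x→u z<s 1<n ∘ sym , arc-≢ u→y z<s 2+e<n) ,
       (arc-≢ x→v z<s 2+e<n ∘ sym , arc-≢ v→y z<s 1<n) ,
       arc-≢ u→v z<s 1+e<n ,
       trans (dist-sym 3≤n u x) (dist-arc-cong 3≤n x u v y x→u v→y (<⇒≤ 1<n)) ,
       trans (dist-arc-cong 3≤n u y x v u→y x→v (<⇒≤ 2+e<n)) (dist-sym 3≤n x v)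

  confuses-[x,y] : 6 ≤ n → ∀ {x y} → x ≢ y → Confuses (x ∷ y ∷ [])
  confuses-[x,y] 6≤n {x} {y} x≢y
    with long-arc 6≤n (toℕ<n x) (toℕ<n y) (x≢y ∘ toℕ-injective)
  ... | e , e<n , inj₁ x→y =
    let u , v , (u≢x , u≢y) , (v≢x , v≢y) , u≢v , ux≡vy , uy≡vx = inner-neighbours x y x→y e<n
    in u , v , ∉-pair u≢x u≢y , ∉-pair v≢x v≢y , u≢v , swapped ux≡vy uy≡vx
  ... | e , e<n , inj₂ y→x =
    let u , v , (u≢y , u≢x) , (v≢y , v≢x) , u≢v , uy≡vx , ux≡vy = inner-neighbours y x y→x e<n
    in u , v , ∉-pair u≢x u≢y , ∉-pair v≢x v≢y , u≢v , swapped ux≡vy uy≡vx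

  ¬confuses⇒3≤ : 6 ≤ n → ∀ {xs} → Unique xs → ¬ Confuses xs → 3 ≤ length xs
  ¬confuses⇒3≤ 6≤n {[]}            _                ¬c = contradiction confuses-[] ¬c
  ¬confuses⇒3≤ 6≤n {x ∷ []}        _                ¬c = contradiction (confuses-[x] x) ¬c
  ¬confuses⇒3≤ 6≤n {_ ∷ _ ∷ []}    ((x≢y All.∷ _) AllPairs.∷ _) ¬c =
    contradiction (confuses-[x,y] 6≤n x≢y) ¬c
  ¬confuses⇒3≤ 6≤n {_ ∷ _ ∷ _ ∷ _} _                _  = s≤s (s≤s (s≤s z≤n))

resolving⇒3≤ : ∀ (3≤n : 3 ≤ n) → 6 ≤ n → HasResolvingSetOfSize (cycle n 3≤n) k → 3 ≤ k
resolving⇒3≤ {n} 3≤n 6≤n (S , refl , resolves) = subst (3 ≤_) (length-members S)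
  (¬confuses⇒3≤ 3≤n 6≤n (filter⁺ (_∈? S) (allFin⁺ n))
    λ (u , v , u∉ , v∉ , u≢v , p) → resolves u v
      (u∉ ∘ ∈-filter⁺ (_∈? S) (∈-allFin u)) (v∉ ∘ ∈-filter⁺ (_∈? S) (∈-allFin v)) u≢v p)

-- Upper bound: sorted distances to 0, 1 and 3.

-- Profile n u a p q: the distances from u to 0, 1 and 3, sorted, are a, p + a, q + (p + a).
-- The oddᵢ and evenᵢ are the vertices opposite to 0, 1 and 3, for n of that parity.
data Profile (n : ℕ) : (u a p q : ℕ) → Set where
  two        :                           Profile n 2       1       0 1
  ascending  :                           Profile n (4 + k) (1 + k) 2 1
  descending : i + suc k ≡ n           → Profile n i       (1 + k) 1 2
  odd₀       :                           Profile n (4 + k) (1 + k) 2 0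
  even₀      : n ≡ 6 + (k + k)         → Profile n (4 + k) (1 + k) 1 1
  odd₁       :                           Profile n (5 + k) (2 + k) 0 1
  even₁      :                           Profile n (4 + k) k       1 0
  odd₂       : n ≡ 5 + (k + k)         → Profile n (5 + k) k       1 1

-- Different constructors share their gaps in two cases only: `two` and `odd₁` differ in the
-- smallest distance, 1 against at least 2, while `even₀` and `odd₂` need `n` of different parity.
profile-injective : ∀ {u v a p q} → Profile n u a p q → Profile n v a p q → u ≡ v
profile-injective two               two               = refl
profile-injective ascending         ascending         = refl
profile-injective (descending refl) (descending eq)   = sym (+-cancelʳ-≡ _ _ _ eq)
profile-injective odd₀              odd₀              = refl
profile-injective (even₀ _)         (even₀ _)         = refl
profile-injective odd₁              odd₁              = refl
profile-injective even₁             even₁             = refl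
profile-injective (odd₂ _)          (odd₂ _)          = refl
profile-injective (even₀ {k} refl)  (odd₂ eq)         =
  linear-⊥ 0 (≤-reflexive (sym eq)) (solve (k ∷ []))
profile-injective (odd₂ eq)         (even₀ {k} refl)  =
  linear-⊥ 0 (≤-reflexive (sym eq)) (solve (k ∷ []))

-- A certificate that the cyclic distance of `i` and `j` is `d`, whichever direction is the shorter.
record Short (n i j d : ℕ) : Set where
  constructor short
  field
    arc    : Arc n i j d ⊎ Arc n j i d
    d+d≤n : d + d ≤ n

-- Here and in `backward`, `c` is the slack in `d + d ≤ n`.
forward : ∀ c → i + d ≡ j → d + d + c ≡ n → Short n i j d
forward _ eq 2d+c≡n = short (inj₁ (inj₁ eq)) (m+n≤o⇒m≤o _ (≤-reflexive 2d+c≡n))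

backward : ∀ c → j + d ≡ i + n → d + d + c ≡ n → Short n i j d
backward _ eq 2d+c≡n = short (inj₂ (inj₂ eq)) (m+n≤o⇒m≤o _ (≤-reflexive 2d+c≡n))

Profiled : ℕ → ℕ → Set
Profiled n u = ∃[ a ] ∃[ p ] ∃[ q ] Profile n u a p q × ∃[ d₀ ] ∃[ d₁ ] ∃[ d₃ ]
  Short n 0 u d₀ × Short n 1 u d₁ × Short n 3 u d₃ ×
  d₀ ∷ d₁ ∷ d₃ ∷ [] ↭ a ∷ p + a ∷ q + (p + a) ∷ []

profile-2 : 6 ≤ n → Profiled n 2
profile-2 6≤n = _ , _ , _ , two , 2 , 1 , 1 ,
  short (inj₁ (inj₁ refl)) (≤-trans (m≤m+n 4 2) 6≤n) ,
  short (inj₁ (inj₁ refl)) (≤-trans (m≤m+n 2 4) 6≤n) ,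
  short (inj₂ (inj₁ refl)) (≤-trans (m≤m+n 2 4) 6≤n) , ↭-reverse (1 ∷ 1 ∷ 2 ∷ [])

-- `w` counts the vertices after `u`, and `s` is the excess of `2u` over `n + 6`; both `n` and `u`
-- are then sums without subtraction.
profile-descending : ∀ w s → Profiled (8 + (w + s) + w) (7 + (w + s))
profile-descending w s =
  _ , _ , _ , descending {k = w} (solve (w ∷ s ∷ [])) , 1 + w , 2 + w , 4 + w ,
  backward (6 + s) (solve (w ∷ s ∷ [])) (solve (w ∷ s ∷ [])) ,
  backward (4 + s) (solve (w ∷ s ∷ [])) (solve (w ∷ s ∷ [])) ,
  backward s (solve (w ∷ s ∷ [])) (solve (w ∷ s ∷ [])) , ↭-refl

-- The case `k = 0` is `n = 5`, where the vertices 4 and 2 both have distances 1, 1, 2; it is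
-- excluded by `6 ≤ n`.
profile-odd₁ : ∀ k → n ≡ 5 + (k + k) → 6 ≤ n → Profiled n (4 + k)
profile-odd₁ 0       refl 5<5 = contradiction 5<5 1+n≰n
profile-odd₁ (suc k) refl _   =
  _ , _ , _ , odd₁ , 2 + k , 3 + k , 2 + k ,
  backward 3 (solve (k ∷ [])) (solve (k ∷ [])) , backward 1 (solve (k ∷ [])) (solve (k ∷ [])) ,
  forward 3 refl (solve (k ∷ [])) , ↭-prep _ (↭-swap _ _ ↭-refl)

profile-odd₂ : ∀ k → n ≡ 3 + (k + k) → 6 ≤ n → Profiled n (4 + k)
profile-odd₂ 0       refl (s≤s (s≤s (s≤s ())))
profile-odd₂ (suc k) refl _ =
  _ , _ , _ , odd₂ {k = k} (solve (k ∷ [])) , k , 1 + k , 2 + k ,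
  backward 5 (solve (k ∷ [])) (solve (k ∷ [])) , backward 3 (solve (k ∷ [])) (solve (k ∷ [])) ,
  forward 1 refl (solve (k ∷ [])) , ↭-refl

-- The cases are by the excess of 2u over n for u = 4 + k, which is between 1 and 5 for
-- the vertices opposite to 0, 1 and 3.
profile : 6 ≤ n → 4 + k < n → Profiled n (4 + k)
profile {n} {k} 6≤n u<n with 4 + k + (4 + k) ≤? n
... | yes u+u≤n with s , refl ← m≤n⇒∃[o]m+o≡n u+u≤n =
  _ , _ , _ , ascending , 4 + k , 3 + k , 1 + k ,
  forward s refl refl , forward (2 + s) refl (solve (k ∷ s ∷ [])) ,
  forward (6 + s) refl (solve (k ∷ s ∷ [])) , ↭-reverse (1 + k ∷ 3 + k ∷ 4 + k ∷ [])
-- The remainder matched on is the excess less one, since it is measured from `suc n`.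
... | no u+u≰n with m≤n⇒∃[o]m+o≡n (≰⇒> u+u≰n)
...   | 0 , eq with refl ← linear-≡ {p = n} {q = 7 + (k + k)} eq (solve (n ∷ k ∷ [])) =
  _ , _ , _ , odd₀ , 3 + k , 3 + k , 1 + k ,
  backward 1 (solve (k ∷ [])) (solve (k ∷ [])) , forward 1 refl (solve (k ∷ [])) ,
  forward 5 refl (solve (k ∷ [])) , ↭-reverse (1 + k ∷ 3 + k ∷ 3 + k ∷ [])
...   | 1 , eq with refl ← linear-≡ {p = n} {q = 6 + (k + k)} eq (solve (n ∷ k ∷ [])) =
  _ , _ , _ , even₀ refl , 2 + k , 3 + k , 1 + k ,
  backward 2 (solve (k ∷ [])) (solve (k ∷ [])) , forward 0 refl (solve (k ∷ [])) ,
  forward 4 refl (solve (k ∷ [])) , shift (1 + k) (2 + k ∷ 3 + k ∷ []) []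
...   | 2 , eq = profile-odd₁ k (linear-≡ {p = n} {q = 5 + (k + k)} eq (solve (n ∷ k ∷ []))) 6≤n
...   | 3 , eq with refl ← linear-≡ {p = n} {q = 4 + (k + k)} eq (solve (n ∷ k ∷ [])) =
  _ , _ , _ , even₁ , k , 1 + k , 1 + k ,
  backward 4 (solve (k ∷ [])) (solve (k ∷ [])) , backward 2 (solve (k ∷ [])) (solve (k ∷ [])) ,
  forward 2 refl (solve (k ∷ [])) , ↭-refl
...   | 4 , eq = profile-odd₂ k (linear-≡ {p = n} {q = 3 + (k + k)} eq (solve (n ∷ k ∷ []))) 6≤n
...   | suc (suc (suc (suc (suc s)))) , eq
  with w , refl ← m≤n⇒∃[o]m+o≡n u<n
  with refl ← linear-≡ {p = k} {q = 3 + (w + s)} (sym eq) (solve (k ∷ w ∷ s ∷ [])) =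
  profile-descending w s

sorted : ∀ a p q → Sorted (a ∷ p + a ∷ q + (p + a) ∷ [])
sorted a p q = m≤n+m a p ListLinked.∷ m≤n+m (p + a) q ListLinked.∷ ListLinked.[-]

-- Sorted lists that are permutations of each other agree entry by entry, and cancellation recovers
-- the gaps.
sorted-injective : ∀ {a p q a′ p′ q′} →
  a ∷ p + a ∷ q + (p + a) ∷ [] ↭ a′ ∷ p′ + a′ ∷ q′ + (p′ + a′) ∷ [] → a ≡ a′ × p ≡ p′ × q ≡ q′
sorted-injective {a} {p} {q} {a′} {p′} {q′} perm
  with refl Pointwise.∷ pa Pointwise.∷ qpa Pointwise.∷ Pointwise.[] ←
    ↗↭↗⇒≋ ≤-totalOrder (sorted a p q) (sorted a′ p′ q′) (↭⇒↭ₛ perm)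
  with refl ← +-cancelʳ-≡ a p p′ pa
  with refl ← +-cancelʳ-≡ (p + a) q q′ qpa = refl , refl , refl

sorted-distances-injective : ∀ {u v a p q a′ p′ q′} → Profile n u a p q → Profile n v a′ p′ q′ →
  a ∷ p + a ∷ q + (p + a) ∷ [] ↭ a′ ∷ p′ + a′ ∷ q′ + (p′ + a′) ∷ [] → u ≡ v
sorted-distances-injective {a = a} {p} {q} {a′} {p′} {q′} prof-u prof-v perm
  with refl , refl , refl ← sorted-injective {a} {p} {q} {a′} {p′} {q′} perm
  = profile-injective prof-u prof-v

-- The resolving set of the vertices 0, 1 and 3.

S₀₁₃ : Subset (4 + n)
S₀₁₃ = inside Vec.∷ inside Vec.∷ outside Vec.∷ inside Vec.∷ ⊥

-- The first four membership tests compute; no later vertex passes, as the tail of the set is `⊥`.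
members-S₀₁₃ : members (S₀₁₃ {n}) ≡ zero ∷ suc zero ∷ suc (suc (suc zero)) ∷ []
members-S₀₁₃ {n} = cong (λ xs → zero ∷ suc zero ∷ suc (suc (suc zero)) ∷ xs)
  (filter-none (_∈? S₀₁₃ {n}) (All.tabulate⁺ {f = λ i → suc (suc (suc (suc i)))}
    λ { i (Vec.there (Vec.there (Vec.there (Vec.there i∈⊥)))) → ∉⊥ i∈⊥ }))

∣S₀₁₃∣≡3 : ∀ n → ∣ S₀₁₃ {n} ∣ ≡ 3
∣S₀₁₃∣≡3 n = cong (3 +_) (∣⊥∣≡0 n)

outside-profiled : 6 ≤ 4 + n → ∀ u → u Subset.∉ S₀₁₃ {n} → Profiled (4 + n) (toℕ u)
outside-profiled 6≤n zero                         u∉S = contradiction Vec.here u∉S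
outside-profiled 6≤n (suc zero)                   u∉S = contradiction (Vec.there Vec.here) u∉S
outside-profiled 6≤n (suc (suc zero))             u∉S = profile-2 6≤n
outside-profiled 6≤n (suc (suc (suc zero)))       u∉S =
  contradiction (Vec.there (Vec.there (Vec.there Vec.here))) u∉S
outside-profiled 6≤n u@(suc (suc (suc (suc _)))) u∉S = profile 6≤n (toℕ<n u)

short⇒dist : ∀ (3≤n : 3 ≤ n) u v → Short n (toℕ v) (toℕ u) d → dist (cycle n 3≤n) u v ≡ d
short⇒dist 3≤n u v (short (inj₁ arc) d+d≤n) = arc⇒dist′ 3≤n v u arc d+d≤n
short⇒dist 3≤n u v (short (inj₂ arc) d+d≤n) = arc⇒dist 3≤n u v arc d+d≤n

map-triple : ∀ {A : Set} {f : A → ℕ} {xs a b c} → xs ≡ a ∷ b ∷ c ∷ [] →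
             f a ≡ i → f b ≡ j → f c ≡ k → map f xs ≡ i ∷ j ∷ k ∷ []
map-triple refl refl refl refl = refl

multisetRep-profile : ∀ (3≤n : 3 ≤ 4 + n) → 6 ≤ 4 + n → ∀ u → u Subset.∉ S₀₁₃ {n} →
  ∃[ a ] ∃[ p ] ∃[ q ] Profile (4 + n) (toℕ u) a p q ×
    multisetRep (cycle (4 + n) 3≤n) u S₀₁₃ ↭ a ∷ p + a ∷ q + (p + a) ∷ []
multisetRep-profile {n} 3≤n 6≤n u u∉S =
  let a , p , q , prof , d₀ , d₁ , d₃ , s₀ , s₁ , s₃ , perm = outside-profiled 6≤n u u∉S
  in a , p , q , prof , ↭-trans (↭-reflexive (map-triple members-S₀₁₃
       (short⇒dist 3≤n u zero s₀) (short⇒dist 3≤n u (suc zero) s₁)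
       (short⇒dist 3≤n u (suc (suc (suc zero))) s₃))) perm

S₀₁₃-resolving : ∀ (3≤n : 3 ≤ 4 + n) → 6 ≤ 4 + n →
                 IsOuterMultisetResolving (cycle (4 + n) 3≤n) (S₀₁₃ {n})
S₀₁₃-resolving 3≤n 6≤n u v u∉S v∉S u≢v same =
  let _ , _ , _ , prof-u , rep-u = multisetRep-profile 3≤n 6≤n u u∉S
      _ , _ , _ , prof-v , rep-v = multisetRep-profile 3≤n 6≤n v v∉S
  in u≢v (toℕ-injective (sorted-distances-injective prof-u prof-v
       (↭-trans (↭-sym rep-u) (↭-trans same rep-v))))

S₀₁₃-size-3 : ∀ (3≤n : 3 ≤ 4 + n) → 6 ≤ 4 + n → HasResolvingSetOfSize (cycle (4 + n) 3≤n) 3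
S₀₁₃-size-3 {n} 3≤n 6≤n = S₀₁₃ {n} , ∣S₀₁₃∣≡3 n , S₀₁₃-resolving {n} 3≤n 6≤n

-- Matching on the equation puts `n` in the form `4 + _` required by `S₀₁₃`, for any given proof
-- `3≤n`.
resolving-3 : ∀ m → 6 + m ≡ n → (3≤n : 3 ≤ n) → HasResolvingSetOfSize (cycle n 3≤n) 3
resolving-3 m refl 3≤n = S₀₁₃-size-3 {2 + m} 3≤n (m≤m+n 6 m)

mainTheorem7 : ∀ (n : ℕ) (6≤n : 6 ≤ n) → dimₘₛ (cycle n (≤-trans (m≤m+n 3 3) 6≤n)) ≡ 3
mainTheorem7 n 6≤n =
  let 3≤n = ≤-trans (m≤m+n 3 3) 6≤n
      m , 6+m≡n = m≤n⇒∃[o]m+o≡n 6≤n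
      _ , resolving , minimal = smallestResolvingSet (cycle n 3≤n)
  in ≤-antisym (minimal 3 (resolving-3 m 6+m≡n 3≤n)) (resolving⇒3≤ 3≤n 6≤n resolving)
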